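{- Let $n$ and $k$ be integers with $3\le k< n/2$ and \[ n\ge\begin{cases} 8, & k=3,\\ 10, & k=4,\\ \frac{k(k+1)}{2}, & k \text{ odd and } k\ge 5,\\ \frac{k^2}{2}, & k \text{ even and } k\ge 6. \end{cases} \] Then the generalized Petersen graph $GP(n,k)$ is ${\rm diam}(GP(n,k))$-distance-balanced.
   Context: For $n\ge 3$ and $1\le k<n/2$, the generalized Petersen graph $GP(n,k)$ has vertex set $\{u_i: i\in\mathbb{Z}_n\}\cup\{v_i: i\in\mathbb{Z}_n\}$ and edge set $\{u_iu_{i+1}: i\in\mathbb{Z}_n\}\cup\{v_iv_{i+k}: i\in\mathbb{Z}_n\}\cup\{u_iv_i: i\in\mathbb{Z}_n\}$ (indices mod $n$). For a connected graph $G$, $d_G(x,y)$ is the shortest-path distance and ${\rm diam}(G)$ is the maximum distance. For $x,y\in V(G)$, $W_{xy}=\{w\in V(G): d_G(w,x)<d_G(w,y)\}$. For an integer $\ell$ with $1\le \ell\le {\rm diam}(G)$, $G$ is called $\ell$-distance-balanced if $|W_{xy}|=|W_{yx}|$ for every pair $x,y\in V(G)$ with $d_G(x,y)=\ell$. -}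

module Defs where

open import Data.Nat using (ℕ; zero; suc; _+_; _*_; _∸_; _≤_; _<_; _⊔_; _<ᵇ_; _≡ᵇ_)
open import Data.Nat.DivMod using (_%_; m%n<n)
open import Data.Fin using (Fin; toℕ; fromℕ<)
open import Data.Fin.Properties using () renaming (_≟_ to _≟ᶠ_)
open import Data.Bool using (Bool; true; false; _∨_; _∧_; if_then_else_)
open import Data.Bool.ListAction using (any)
open import Data.List using (List; []; _∷_; _++_; map; length; filter; foldr; concatMap)
open import Data.List.Base using (allFin)
open import Relation.Nullary.Decidable using (⌊_⌋)

_+ₘ_ : ∀ {n} → Fin n → ℕ → Fin n
_+ₘ_ {suc m} i a = fromℕ< (m%n<n (toℕ i + a) (suc m))

-- vertices of GP(n,k): u_i (outer) and v_i (inner), i ∈ Z_n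
data V (n : ℕ) : Set where
  u : Fin n → V n
  v : Fin n → V n

vertices : (n : ℕ) → List (V n)
vertices n = map u (allFin n) ++ map v (allFin n)

_==_ : ∀ {n} → V n → V n → Bool
u i == u j = ⌊ i ≟ᶠ j ⌋
v i == v j = ⌊ i ≟ᶠ j ⌋
_ == _ = false

-- neighbourhood in GP(n,k): edges u_i u_{i+1}, v_i v_{i+k}, u_i v_i
-- (i - a is computed as i + (n - a) mod n; used only with a < n)
neighbours : (n k : ℕ) → V n → List (V n)
neighbours n k (u i) = u (i +ₘ 1) ∷ u (i +ₘ (n ∸ 1)) ∷ v i ∷ []
neighbours n k (v i) = v (i +ₘ k) ∷ v (i +ₘ (n ∸ k)) ∷ u i ∷ []

within : (n k : ℕ) → ℕ → V n → V n → Bool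
within n k zero    x y = x == y
within n k (suc m) x y = within n k m x y ∨ any (within n k m x) (neighbours n k y)

search : (n k : ℕ) → V n → V n → (start fuel : ℕ) → ℕ
search n k x y start zero = start
search n k x y start (suc fuel) =
  if within n k start x y then start else search n k x y (suc start) fuel

-- shortest-path distance d(x,y) in GP(n,k) (the graph has 2n vertices and is
-- connected, so the distance is < 2n and is found by the search)
dist : (n k : ℕ) → V n → V n → ℕ
dist n k x y = search n k x y 0 (2 * n)

diam : (n k : ℕ) → ℕ
diam n k = foldr _⊔_ 0
  (concatMap (λ x → map (dist n k x) (vertices n)) (vertices n))

Wsize : (n k : ℕ) → V n → V n → ℕ
Wsize n k x y = length (filter (λ w → dist n k w x Data.Nat.<? dist n k w y) (vertices n))

DistanceBalanced : (n k ℓ : ℕ) → Set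
DistanceBalanced n k ℓ =
  ∀ (x y : V n) → dist n k x y ≡ ℓ → Wsize n k x y ≡ Wsize n k y x
  where open import Relation.Binary.PropositionalEquality using (_≡_)

bound : ℕ → ℕ
bound 3 = 8
bound 4 = 10
bound k = if k Data.Nat.% 2 ≡ᵇ 1 then (k * (k + 1)) Data.Nat./ 2 else (k * k) Data.Nat./ 2

{-# OPTIONS --safe #-}
module Submission where

-- A walk between u_i and v_{i+δ} using a rim steps and b chords has a + bk ≡ δ (mod n), so
-- d(u_i, v_{i+δ}) = N(δ) + 1 for N(δ) = min {|a| + |b| : a + bk ≡ δ}.  When k ≤ δ ≤ n - k,
-- a walk from u_i to u_{i+δ} that never leaves the rim is improved by a chord because k ≥ 3,
-- hence d(u_i, u_{i+δ}) = N(δ) + 2.  For the remaining δ one has N(δ) ≤ Q := ⌈k/2⌉, while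
-- the lower bound on n yields some k ≤ j ≤ n - k with N(j) ≥ Q: if n = qk + r, then q ≥ Q,
-- and j = k + Q - 1 (for r ≥ Q) or j = k + Q (for r < Q) works.  So d(u_i, v_j) never
-- attains the diameter, and for the pairs u_i, u_j and v_i, v_j the reflection
-- x ↦ i + j - x is an automorphism exchanging the two vertices.

open import Defs
open import Data.Bool using (Bool; true; false; T; if_then_else_)
open import Data.Bool.Properties using (T-∨)
open import Data.Fin using (Fin; toℕ; fromℕ<)
import Data.Fin.Properties as Fin
open import Data.Integer as ℤ using (ℤ; +_; -[1+_]; ∣_∣; 0ℤ; 1ℤ; -1ℤ; +≤+)
import Data.Integer.DivMod as ℤ
import Data.Integer.Properties as ℤ
open import Algebra.Properties.AbelianGroup ℤ.+-0-abelianGroup using (∙-cancelˡ)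
open import Data.Integer.Tactic.RingSolver using (solve)
open import Data.List using (List; []; _∷_; map; allFin; filter; length; foldr)
open import Data.List.Membership.Propositional using (_∈_; find; lose)
open import Data.List.Membership.Propositional.Properties
  using (∈-map⁺; ∈-map⁻; ∈-++⁺ˡ; ∈-++⁺ʳ; ∈-allFin; ∈-concatMap⁺)
open import Data.List.Membership.Propositional.Properties.WithK using (unique∧set⇒bag)
open import Data.List.Properties using (filter-≐)
open import Data.List.Relation.Binary.BagAndSetEquality using (∼bag⇒↭)
open import Data.List.Relation.Binary.Permutation.Propositional using (_↭_)
open import Data.List.Relation.Binary.Permutation.Propositional.Properties using (↭-length; filter-↭)
open import Data.List.Relation.Unary.Any using (here; there)
import Data.List.Relation.Unary.Any.Properties as Any
open import Data.List.Relation.Unary.Unique.Propositional using (Unique)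
import Data.List.Relation.Unary.Unique.Propositional.Properties as Unique
open import Data.Nat as ℕ using (ℕ; zero; suc; z≤n; s≤s; _≡ᵇ_)
import Data.Nat.DivMod as ℕ
import Data.Nat.Properties as ℕ
open import Data.Nat.Tactic.RingSolver using () renaming (solve to solveℕ)
open import Data.Product using (∃; ∃₂; ∃-syntax; _×_; _,_; proj₁; proj₂)
open import Data.Sum using (_⊎_; inj₁; inj₂)
open import Data.Unit using (tt)
open import Function using (_∘_; mk⇔; Equivalence)
open import Relation.Binary.PropositionalEquality
open import Relation.Nullary using (Dec; yes; no; contradiction; fromWitness; toWitness)
open import Relation.Unary using (Decidable)

-- Lower bounds for the weight |a| + |b| over the integers.

module IntegerBounds where
  open import Data.Integer using (_+_; _-_; -_; _*_; _≤_)

  i≤∣i∣ : ∀ i → i ≤ + ∣ i ∣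
  i≤∣i∣ (+ n)    = ℤ.≤-refl
  i≤∣i∣ -[1+ n ] = ℤ.-≤+

  -i≤∣i∣ : ∀ i → - i ≤ + ∣ i ∣
  -i≤∣i∣ i = subst (λ a → - i ≤ + a) (ℤ.∣-i∣≡∣i∣ i) (i≤∣i∣ (- i))

  -- The strict case reads `c + 1ℤ ≤ b`, so that `gap` turns either case into a nonnegative term for
  -- `certify`.
  split : ∀ b c → b ≤ c ⊎ c + 1ℤ ≤ b
  split b c with b ℤ.≤? c
  ... | yes b≤c = inj₁ b≤c
  ... | no  b≰c = inj₂ (subst (_≤ b) (ℤ.+-comm 1ℤ c) (ℤ.i<j⇒suc[i]≤j (ℤ.≰⇒> b≰c)))

  gap : ∀ {i j} → i ≤ j → 0ℤ ≤ j - i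
  gap = ℤ.i≤j⇒0≤j-i

  infixl 6 _⊕_
  infixl 7 _⊗_
  _⊕_ : ∀ {i j} → 0ℤ ≤ i → 0ℤ ≤ j → 0ℤ ≤ i + j
  _⊕_ = ℤ.+-mono-≤

  _⊗_ : ∀ {i j} → 0ℤ ≤ i → 0ℤ ≤ j → 0ℤ ≤ i * j
  _⊗_ (+≤+ {n = m} _) (+≤+ {n = n} _) = subst (0ℤ ≤_) (ℤ.pos-* m n) (+≤+ z≤n)

  -- Inequalities are certified by writing the difference of the two sides as a sum of products
  -- of nonnegative terms; the identity is then left to the ring solver.
  certify : ∀ {i j e} → 0ℤ ≤ e → j - i ≡ e → i ≤ j
  certify 0≤e eq = ℤ.0≤i-j⇒j≤i (subst (0ℤ ≤_) (sym eq) 0≤e)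

  0≤1 : 0ℤ ≤ 1ℤ
  0≤1 = +≤+ z≤n

  0≤k+1 : ∀ {k} → 1ℤ ≤ k → 0ℤ ≤ k + 1ℤ
  0≤k+1 1≤k = ℤ.+-mono-≤ (ℤ.≤-trans 0≤1 1≤k) 0≤1

  -- A and B stand for |a| and |b|.
  module _ {k Q : ℤ} (1≤k : 1ℤ ≤ k) {a b A B : ℤ}
           (a≤A : a ≤ A) (-a≤A : - a ≤ A) (b≤B : b ≤ B) (0≤A : 0ℤ ≤ A) where

    -- With at most `q` chords, each of the `q - b` missing ones is replaced by `k ≥ 1` rim steps,
    -- so `a + b ≥ q`; with more than `q` chords, `b` alone suffices.
    weight-beyond : ∀ {q} → Q ≤ q → q * k ≤ a + b * k → Q ≤ A + B
    weight-beyond {q} Q≤q h = by-cases (split b q)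
      where
      by-cases : b ≤ q ⊎ q + 1ℤ ≤ b → Q ≤ A + B
      by-cases (inj₁ b≤q) = certify
        (gap Q≤q ⊕ gap a≤A ⊕ gap b≤B ⊕ gap h ⊕ gap b≤q ⊗ gap 1≤k)
        (solve (A ∷ B ∷ a ∷ b ∷ k ∷ Q ∷ q ∷ []))
      by-cases (inj₂ q<b) = certify
        (gap Q≤q ⊕ 0≤A ⊕ gap b≤B ⊕ gap q<b ⊕ 0≤1)
        (solve (A ∷ B ∷ b ∷ Q ∷ q ∷ []))

    -- For `b ≤ 1`, `a = c + (1 - b)k` gives `a + b ≥ c + 1 ≥ Q`. For `b ≥ 2` the rim steps go
    -- backwards, and `b - a ≥ k - c + 2 ≥ Q + 1`, because `c ≤ Q` and `2Q ≤ k + 1`.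
    weight-near : ∀ {c} → Q ≤ 1ℤ + c → c ≤ Q → Q + Q ≤ k + 1ℤ →
                  a + b * k ≡ k + c → Q ≤ A + B
    weight-near {c} Q≤1+c c≤Q 2Q≤k+1 eq = by-cases (split b 1ℤ)
      where
      by-cases : b ≤ 1ℤ ⊎ 1ℤ + 1ℤ ≤ b → Q ≤ A + B
      by-cases (inj₁ b≤1) = certify
        (gap a≤A ⊕ gap b≤B ⊕ gap (ℤ.≤-reflexive (sym eq)) ⊕ gap b≤1 ⊗ gap 1≤k ⊕ gap Q≤1+c)
        (solve (A ∷ B ∷ a ∷ b ∷ k ∷ Q ∷ c ∷ []))
      by-cases (inj₂ 2≤b) = certify
        (gap -a≤A ⊕ gap b≤B ⊕ gap (ℤ.≤-reflexive eq) ⊕ gap 2≤b ⊗ 0≤k+1 1≤k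
          ⊕ gap 2Q≤k+1 ⊕ gap c≤Q ⊕ 0≤1)
        (solve (A ∷ B ∷ a ∷ b ∷ k ∷ Q ∷ c ∷ []))

    -- If `b < q`, then `a = (q - 1 - b)k + (r - c)` with `r - c ≥ 1`, hence `a + b ≥ q`.
    weight-far₁ : ∀ {c q r} → Q ≤ q → c + 1ℤ ≤ r →
                  a + b * k ≡ q * k + r - (k + c) → Q ≤ A + B
    weight-far₁ {c} {q} {r} Q≤q c<r eq = by-cases (split q b)
      where
      by-cases : q ≤ b ⊎ b + 1ℤ ≤ q → Q ≤ A + B
      by-cases (inj₁ q≤b) = certify (0≤A ⊕ gap b≤B ⊕ gap q≤b ⊕ gap Q≤q)
        (solve (A ∷ B ∷ b ∷ Q ∷ q ∷ []))
      by-cases (inj₂ b<q) = certify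
        (gap a≤A ⊕ gap b≤B ⊕ gap (ℤ.≤-reflexive (sym eq)) ⊕ gap b<q ⊗ gap 1≤k ⊕ gap c<r ⊕ gap Q≤q)
        (solve (A ∷ B ∷ a ∷ b ∷ k ∷ Q ∷ c ∷ q ∷ r ∷ []))

    -- Now `r - c` is negative. For `b ≥ q - 1` the rim steps go backwards and `b - a ≥ q`; for
    -- `b ≤ q - 2` one gets `a + b ≥ k + q - 2 + r - c`, which is at least `Q` since `c ≤ Q` and
    -- `2Q + 2 ≤ k + q`.
    weight-far₂ : ∀ {c q r} → Q ≤ q → 0ℤ ≤ r → r + 1ℤ ≤ c → c ≤ Q → Q + Q + + 2 ≤ k + q →
                  a + b * k ≡ q * k + r - (k + c) → Q ≤ A + B
    weight-far₂ {c} {q} {r} Q≤q 0≤r r<c c≤Q 2Q+2≤k+q eq = by-cases (split q (b + 1ℤ))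
      where
      by-cases : q ≤ b + 1ℤ ⊎ b + 1ℤ + 1ℤ ≤ q → Q ≤ A + B
      by-cases (inj₁ q≤b+1) = certify
        (gap -a≤A ⊕ gap b≤B ⊕ gap (ℤ.≤-reflexive eq) ⊕ gap q≤b+1 ⊗ 0≤k+1 1≤k ⊕ gap r<c ⊕ gap Q≤q)
        (solve (A ∷ B ∷ a ∷ b ∷ k ∷ Q ∷ c ∷ q ∷ r ∷ []))
      by-cases (inj₂ b+2≤q) = certify
        (gap a≤A ⊕ gap b≤B ⊕ gap (ℤ.≤-reflexive (sym eq)) ⊕ gap b+2≤q ⊗ gap 1≤k
          ⊕ 0≤r ⊕ gap c≤Q ⊕ gap 2Q+2≤k+q)
        (solve (A ∷ B ∷ a ∷ b ∷ k ∷ Q ∷ c ∷ q ∷ r ∷ []))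

open IntegerBounds

-- The residue k + c has weight at least Q modulo n.

module Distant {k Q q r c n : ℕ} (1≤k : 1 ℕ.≤ k)
  (Q≤1+c : Q ℕ.≤ suc c) (c≤Q : c ℕ.≤ Q) (2Q≤1+k : Q ℕ.+ Q ℕ.≤ suc k) (Q≤q : Q ℕ.≤ q)
  (c-r : c ℕ.< r ⊎ r ℕ.< c × Q ℕ.+ Q ℕ.+ 2 ℕ.≤ k ℕ.+ q)
  (n≡qk+r : n ≡ q ℕ.* k ℕ.+ r) (k+c≤n : k ℕ.+ c ℕ.≤ n) where

  open import Data.Integer using (_+_; _-_; -_; _*_; _≤_)

  private
    n≡ : + n ≡ + q * + k + + r
    n≡ = trans (cong +_ n≡qk+r) (cong (_+ + r) (ℤ.pos-* q k))

    suc-pos : ∀ m → + suc m ≡ + m + 1ℤ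
    suc-pos m = cong +_ (ℕ.+-comm 1 m)

    module _ (a b : ℤ) where
      beyond : ∀ {q′} → + Q ≤ q′ → q′ * + k ≤ a + b * + k → + Q ≤ + ∣ a ∣ + + ∣ b ∣
      beyond = weight-beyond (+≤+ 1≤k) (i≤∣i∣ a) (-i≤∣i∣ a) (i≤∣i∣ b) (+≤+ z≤n)

      near : a + b * + k ≡ + k + + c → + Q ≤ + ∣ a ∣ + + ∣ b ∣
      near = weight-near (+≤+ 1≤k) (i≤∣i∣ a) (-i≤∣i∣ a) (i≤∣i∣ b) (+≤+ z≤n) {+ c}
        (+≤+ Q≤1+c) (+≤+ c≤Q) (subst (+ (Q ℕ.+ Q) ≤_) (suc-pos k) (+≤+ 2Q≤1+k))

      far : a + b * + k ≡ + q * + k + + r - (+ k + + c) → + Q ≤ + ∣ a ∣ + + ∣ b ∣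
      far = go c-r
        where
        go : c ℕ.< r ⊎ r ℕ.< c × Q ℕ.+ Q ℕ.+ 2 ℕ.≤ k ℕ.+ q →
             a + b * + k ≡ + q * + k + + r - (+ k + + c) → + Q ≤ + ∣ a ∣ + + ∣ b ∣
        go (inj₁ c<r) = weight-far₁ (+≤+ 1≤k) (i≤∣i∣ a) (-i≤∣i∣ a) (i≤∣i∣ b) (+≤+ z≤n) {+ c}
          (+≤+ Q≤q) (subst (_≤ + r) (suc-pos c) (+≤+ c<r))
        go (inj₂ (r<c , h)) = weight-far₂ (+≤+ 1≤k) (i≤∣i∣ a) (-i≤∣i∣ a) (i≤∣i∣ b) (+≤+ z≤n) {+ c}
          (+≤+ Q≤q) (+≤+ z≤n) (subst (_≤ + c) (suc-pos r) (+≤+ r<c)) (+≤+ c≤Q) (+≤+ h)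

  -- t counts the turns around ℤ/n; t = 0 and t = -1 are the two critical cases.
  module Winding (k q r c n a b t : ℤ) (n≡ : n ≡ q * k + r)
           (eq : a + b * k ≡ (k + c) + t * n) where
    past : 0ℤ ≤ k → 0ℤ ≤ c → 0ℤ ≤ r → 0ℤ ≤ n → 1ℤ ≤ t → q * k ≤ a + b * k
    past 0≤k 0≤c 0≤r 0≤n 1≤t = certify
      (0≤k ⊕ 0≤c ⊕ gap 1≤t ⊗ 0≤n ⊕ 0≤r ⊕ gap (ℤ.≤-reflexive (sym eq)) ⊕ gap (ℤ.≤-reflexive (sym n≡)))
      (solve (a ∷ b ∷ k ∷ q ∷ r ∷ c ∷ n ∷ t ∷ []))

    before : k + c ≤ n → 0ℤ ≤ r → 0ℤ ≤ n → t ≤ -[1+ 1 ] → q * k ≤ - a + - b * k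
    before k+c≤n 0≤r 0≤n t≤-2 = certify
      (gap k+c≤n ⊕ gap t≤-2 ⊗ 0≤n ⊕ 0≤r ⊕ gap (ℤ.≤-reflexive eq) ⊕ gap (ℤ.≤-reflexive (sym n≡)))
      (solve (a ∷ b ∷ k ∷ q ∷ r ∷ c ∷ n ∷ t ∷ []))

    unwound : t ≡ 0ℤ → a + b * k ≡ k + c
    unwound refl = trans eq (ℤ.+-identityʳ _)

    wound-back : t ≡ -1ℤ → - a + - b * k ≡ q * k + r - (k + c)
    wound-back refl = begin
      - a + - b * k          ≡⟨ solve (a ∷ b ∷ k ∷ []) ⟩
      - (a + b * k)          ≡⟨ cong -_ eq ⟩
      - (k + c + -1ℤ * n)    ≡⟨ cong (λ n → - (k + c + -1ℤ * n)) n≡ ⟩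
      - (k + c + -1ℤ * (q * k + r)) ≡⟨ solve (q ∷ r ∷ k ∷ c ∷ []) ⟩
      q * k + r - (k + c)    ∎
      where open ≡-Reasoning

  -- For `t ≥ 1` the displacement is at least `n ≥ qk`, and for `t ≤ -2` the opposite displacement
  -- is, because `k + c ≤ n`; `beyond` settles both. For `t = 0` the displacement is `k + c` itself,
  -- and for `t = -1` the opposite one is `n - (k + c)`.
  weight-distant : ∀ a b t → a + b * + k ≡ + (k ℕ.+ c) + t * + n → Q ℕ.≤ ∣ a ∣ ℕ.+ ∣ b ∣
  weight-distant a b t eq = ℤ.drop‿+≤+ (go t eq)
    where
    flip : + Q ≤ + ∣ - a ∣ + + ∣ - b ∣ → + Q ≤ + ∣ a ∣ + + ∣ b ∣
    flip = subst₂ (λ A B → + Q ≤ + A + + B) (ℤ.∣-i∣≡∣i∣ a) (ℤ.∣-i∣≡∣i∣ b)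
    go : ∀ t → a + b * + k ≡ + (k ℕ.+ c) + t * + n → + Q ≤ + ∣ a ∣ + + ∣ b ∣
    module W t = Winding (+ k) (+ q) (+ r) (+ c) (+ n) a b t n≡
    go (+ 0) eq = near a b (W.unwound 0ℤ eq refl)
    go (+ suc s) eq = beyond a b (+≤+ Q≤q)
      (W.past (+ suc s) eq (+≤+ z≤n) (+≤+ z≤n) (+≤+ z≤n) (+≤+ z≤n) (+≤+ (s≤s z≤n)))
    go -[1+ 0 ] eq = flip (far (- a) (- b) (W.wound-back -1ℤ eq refl))
    go -[1+ suc s ] eq = flip (beyond (- a) (- b) (+≤+ Q≤q)
      (W.before -[1+ suc s ] eq (+≤+ k+c≤n) (+≤+ z≤n) (+≤+ z≤n) (ℤ.-≤- (s≤s z≤n))))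

-- Residues modulo n of integers.

module Residues (N : ℕ) where
  open import Data.Integer using (_+_; _-_; -_; _*_)

  n : ℕ
  n = suc N

  -- Vertex indices are written as `ρ z`, so that index arithmetic takes place in ℤ, where the ring
  -- solver applies.
  ρ : ℤ → Fin n
  ρ z = fromℕ< (ℤ.n%ℕd<d z n)

  private
    toℕ-unique : ∀ (i j : Fin n) s → toℕ i ≡ toℕ j ℕ.+ s ℕ.* n → i ≡ j
    toℕ-unique i j zero    eq = Fin.toℕ-injective (trans eq (ℕ.+-identityʳ _))
    toℕ-unique i j (suc s) eq = contradiction (Fin.toℕ<n i) (ℕ.≤⇒≯ (begin
      n                            ≤⟨ ℕ.m≤m+n n (s ℕ.* n) ⟩
      suc s ℕ.* n                  ≤⟨ ℕ.m≤n+m _ (toℕ j) ⟩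
      toℕ j ℕ.+ suc s ℕ.* n        ≡⟨ eq ⟨
      toℕ i                        ∎))
      where open ℕ.≤-Reasoning

    +-unique : ∀ (i j : Fin n) t → + toℕ i ≡ + toℕ j + t * + n → i ≡ j
    +-unique i j (+ s) eq = toℕ-unique i j s
      (ℤ.+-injective (trans eq (cong (λ e → + toℕ j + e) (sym (ℤ.pos-* s n)))))
    +-unique i j t@(-[1+ s ]) eq = sym (toℕ-unique j i (suc s) (ℤ.+-injective (begin
      + toℕ j                           ≡⟨ cancel (+ toℕ j) (+ n) (+ suc s) ⟩
      + toℕ j + t * + n + + suc s * + n ≡⟨ cong₂ _+_ eq (ℤ.pos-* (suc s) n) ⟨
      + (toℕ i ℕ.+ suc s ℕ.* n)         ∎)))
      where
      open ≡-Reasoning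
      cancel : ∀ j n s → j ≡ j + (- s) * n + s * n
      cancel j n s = solve (j ∷ n ∷ s ∷ [])

  toℕ-ρ : ∀ z → + toℕ (ρ z) ≡ z - (z ℤ./ℕ n) * + n
  toℕ-ρ z = begin
    + toℕ (ρ z)                             ≡⟨ cong +_ (Fin.toℕ-fromℕ< (ℤ.n%ℕd<d z n)) ⟩
    + (z ℤ.%ℕ n)                            ≡⟨ cancel (+ (z ℤ.%ℕ n)) (z ℤ./ℕ n) (+ n) ⟩
    + (z ℤ.%ℕ n) + (z ℤ./ℕ n) * + n - (z ℤ./ℕ n) * + n
      ≡⟨ cong (_- (z ℤ./ℕ n) * + n) (ℤ.a≡a%ℕn+[a/ℕn]*n z n) ⟨
    z - (z ℤ./ℕ n) * + n                    ∎
    where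
    open ≡-Reasoning
    cancel : ∀ r q n → r ≡ r + q * n - q * n
    cancel r q n = solve (r ∷ q ∷ n ∷ [])

  ρ-unique : ∀ i z t → + toℕ i ≡ z + t * + n → i ≡ ρ z
  ρ-unique i z t eq = +-unique i (ρ z) (t + q) (begin
    + toℕ i                          ≡⟨ eq ⟩
    z + t * + n                      ≡⟨ regroup z t q (+ n) ⟩
    z - q * + n + (t + q) * + n      ≡⟨ cong (_+ (t + q) * + n) (toℕ-ρ z) ⟨
    + toℕ (ρ z) + (t + q) * + n      ∎)
    where
    open ≡-Reasoning
    q = z ℤ./ℕ n
    regroup : ∀ z t q n → z + t * n ≡ z - q * n + (t + q) * n
    regroup z t q n = solve (z ∷ t ∷ q ∷ n ∷ [])

  ρ-toℕ : ∀ i → ρ (+ toℕ i) ≡ i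
  ρ-toℕ i = sym (ρ-unique i (+ toℕ i) 0ℤ (sym (ℤ.+-identityʳ _)))

  ρ-cong : ∀ {z z′} t → z ≡ z′ + t * + n → ρ z ≡ ρ z′
  ρ-cong {z} {z′} t eq = ρ-unique (ρ z) z′ (t - q) (begin
    + toℕ (ρ z)                ≡⟨ toℕ-ρ z ⟩
    z - q * + n                ≡⟨ cong (_- q * + n) eq ⟩
    z′ + t * + n - q * + n     ≡⟨ regroup z′ t q (+ n) ⟩
    z′ + (t - q) * + n         ∎)
    where
    open ≡-Reasoning
    q = z ℤ./ℕ n
    regroup : ∀ z t q n → z + t * n - q * n ≡ z + (t - q) * n
    regroup z t q n = solve (z ∷ t ∷ q ∷ n ∷ [])

  ρ-injective : ∀ {z z′} → ρ z ≡ ρ z′ → ∃[ t ] z ≡ z′ + t * + n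
  ρ-injective {z} {z′} eq = q - q′ , (begin
    z                                 ≡⟨ shift z q (+ n) ⟩
    z - q * + n + q * + n             ≡⟨ cong (_+ q * + n) (toℕ-ρ z) ⟨
    + toℕ (ρ z) + q * + n             ≡⟨ cong (λ i → + toℕ i + q * + n) eq ⟩
    + toℕ (ρ z′) + q * + n            ≡⟨ cong (_+ q * + n) (toℕ-ρ z′) ⟩
    z′ - q′ * + n + q * + n           ≡⟨ regroup z′ q q′ (+ n) ⟩
    z′ + (q - q′) * + n               ∎)
    where
    open ≡-Reasoning
    q = z ℤ./ℕ n
    q′ = z′ ℤ./ℕ n
    shift : ∀ z q n → z ≡ z - q * n + q * n
    shift z q n = solve (z ∷ q ∷ n ∷ [])
    regroup : ∀ z q q′ n → z - q′ * n + q * n ≡ z + (q - q′) * n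
    regroup z q q′ n = solve (z ∷ q ∷ q′ ∷ n ∷ [])

  ρ-+ₘ : ∀ z a → ρ z +ₘ a ≡ ρ (z + + a)
  ρ-+ₘ z a = ρ-unique (ρ z +ₘ a) (z + + a) (- (+ p) - q) (begin
    + toℕ (ρ z +ₘ a)                ≡⟨ cong +_ (Fin.toℕ-fromℕ< (ℕ.m%n<n s n)) ⟩
    + (s ℕ.% n)                     ≡⟨ cancel (+ (s ℕ.% n)) (+ p) (+ n) ⟩
    + (s ℕ.% n) + + p * + n - + p * + n
      ≡⟨ cong (λ e → + (s ℕ.% n) + e - + p * + n) (ℤ.pos-* p n) ⟨
    + (s ℕ.% n ℕ.+ p ℕ.* n) - + p * + n ≡⟨ cong (λ e → + e - + p * + n) (ℕ.m≡m%n+[m/n]*n s n) ⟨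
    + toℕ (ρ z) + + a - + p * + n    ≡⟨ cong (λ e → e + + a - + p * + n) (toℕ-ρ z) ⟩
    z - q * + n + + a - + p * + n    ≡⟨ regroup z q (+ n) (+ a) (+ p) ⟩
    z + + a + (- (+ p) - q) * + n    ∎)
    where
    open ≡-Reasoning
    q = z ℤ./ℕ n
    s = toℕ (ρ z) ℕ.+ a
    p = s ℕ./ n
    cancel : ∀ r q n → r ≡ r + q * n - q * n
    cancel r q n = solve (r ∷ q ∷ n ∷ [])
    regroup : ∀ z q n a p → z - q * n + a - p * n ≡ z + a + (- p - q) * n
    regroup z q n a p = solve (z ∷ q ∷ n ∷ a ∷ p ∷ [])

  -- `neighbours` encodes a backward step as adding `n ∸ a`, which differs from subtracting `a` by
  -- one full turn; hence the witness `1ℤ`.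
  ρ-+ₘ-∸ : ∀ z {a} → a ℕ.≤ n → ρ z +ₘ (n ℕ.∸ a) ≡ ρ (z - + a)
  ρ-+ₘ-∸ z {a} a≤n = trans (ρ-+ₘ z (n ℕ.∸ a)) (ρ-cong {z′ = z - + a} 1ℤ (begin
    z + + (n ℕ.∸ a)      ≡⟨ cong (λ e → z + e) (trans (sym (ℤ.⊖-≥ a≤n)) (sym (ℤ.m-n≡m⊖n n a))) ⟩
    z + (+ n - + a)      ≡⟨ regroup z (+ n) (+ a) ⟩
    z - + a + 1ℤ * + n   ∎))
    where
    open ≡-Reasoning
    regroup : ∀ z n a → z + (n - a) ≡ z - a + 1ℤ * n
    regroup z n a = solve (z ∷ n ∷ a ∷ [])

-- Reachability and the search for the distance.

==-refl : ∀ {n} (x : V n) → T (x == x)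
==-refl (u i) = fromWitness refl
==-refl (v i) = fromWitness refl

==⇒≡ : ∀ {n} (x y : V n) → T (x == y) → x ≡ y
==⇒≡ (u i) (u j) i=j = cong u (toWitness i=j)
==⇒≡ (v i) (v j) i=j = cong v (toWitness i=j)

module Walks (n k : ℕ) where

  -- A record rather than a synonym, so that m, x and y can be inferred.
  record Reach (m : ℕ) (x y : V n) : Set where
    constructor reach
    field
      holds : T (within n k m x y)

  reach-extend : ∀ {m x y y′} → Reach m x y → y ∈ neighbours n k y′ → Reach (suc m) x y′
  reach-extend {m} {x} {y} {y′} (reach r) y∈ = reach
    (Equivalence.from (T-∨ {within n k m x y′}) (inj₂ (Any.any⁺ (within n k m x) (lose y∈ r))))

  reach-retract : ∀ m {x y′} → Reach (suc m) x y′ →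
                  Reach m x y′ ⊎ ∃[ y ] y ∈ neighbours n k y′ × Reach m x y
  reach-retract m {x} {y′} (reach r) with Equivalence.to (T-∨ {within n k m x y′}) r
  ... | inj₁ r′ = inj₁ (reach r′)
  ... | inj₂ r′ with y , y∈ , r″ ← find (Any.any⁻ (within n k m x) _ r′) = inj₂ (y , y∈ , reach r″)

  reach-suc : ∀ {m x y} → Reach m x y → Reach (suc m) x y
  reach-suc {m} {x} {y} (reach r) = reach (Equivalence.from (T-∨ {within n k m x y}) (inj₁ r))

  -- The search tries increasing radii and cannot step past `m`, where the test succeeds; if the
  -- fuel runs out earlier, the default value returned is still at most `m`.
  search-≤ : ∀ {m x y} → Reach m x y → ∀ s f → s ℕ.≤ m → search n k x y s f ℕ.≤ m
  search-≤ r s zero    s≤m = s≤m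
  search-≤ {m} {x} {y} r s (suc f) s≤m with within n k s x y in eq
  ... | true  = s≤m
  ... | false = search-≤ r (suc s) f (ℕ.≤∧≢⇒< s≤m λ { refl → subst T eq (Reach.holds r) })

  -- The invariant `m < s + f` leaves enough fuel to arrive at `m`, so the result is a radius that
  -- passed the test and not the out-of-fuel default.
  search-reach : ∀ {m x y} → Reach m x y → ∀ s f → s ℕ.≤ m → m ℕ.< s ℕ.+ f →
                 Reach (search n k x y s f) x y
  search-reach r s zero s≤m m<s =
    contradiction s≤m (ℕ.<⇒≱ (subst (_ ℕ.<_) (ℕ.+-identityʳ s) m<s))
  search-reach {m} {x} {y} r s (suc f) s≤m m<s+f with within n k s x y in eq
  ... | true  = reach (subst T (sym eq) tt)
  ... | false = search-reach r (suc s) f (ℕ.≤∧≢⇒< s≤m λ { refl → subst T eq (Reach.holds r) })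
                  (subst (m ℕ.<_) (ℕ.+-suc s f) m<s+f)

  dist-≤ : ∀ {m x y} → Reach m x y → dist n k x y ℕ.≤ m
  dist-≤ r = search-≤ r 0 (2 ℕ.* n) z≤n

  dist-reach : ∀ {m x y} → Reach m x y → m ℕ.< 2 ℕ.* n → Reach (dist n k x y) x y
  dist-reach r = search-reach r 0 (2 ℕ.* n) z≤n

-- Walks along the rim, the chords and the spokes.

module Petersen (N k : ℕ) (k≤n : k ℕ.≤ suc N) where
  open import Data.Integer using (_+_; _-_; -_; _*_)
  open Residues N
  open Walks n k public

  neighbours-u : ∀ z → neighbours n k (u (ρ z)) ≡ u (ρ (z + 1ℤ)) ∷ u (ρ (z - 1ℤ)) ∷ v (ρ z) ∷ []
  neighbours-u z = cong₂ (λ i j → u i ∷ u j ∷ v (ρ z) ∷ []) (ρ-+ₘ z 1) (ρ-+ₘ-∸ z (s≤s z≤n))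

  neighbours-v : ∀ z → neighbours n k (v (ρ z)) ≡ v (ρ (z + + k)) ∷ v (ρ (z - + k)) ∷ u (ρ z) ∷ []
  neighbours-v z = cong₂ (λ i j → v i ∷ v j ∷ u (ρ z) ∷ []) (ρ-+ₘ z k) (ρ-+ₘ-∸ z k≤n)

  i+j-j≡i : ∀ i j → i + j - j ≡ i
  i+j-j≡i i j = solve (i ∷ j ∷ [])

  i-j+j≡i : ∀ i j → i - j + j ≡ i
  i-j+j≡i i j = solve (i ∷ j ∷ [])

  rim⁺ : ∀ z → u (ρ z) ∈ neighbours n k (u (ρ (z + 1ℤ)))
  rim⁺ z = subst (u (ρ z) ∈_) (sym (neighbours-u (z + 1ℤ)))
    (there (here (cong (u ∘ ρ) (sym (i+j-j≡i z 1ℤ)))))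

  rim⁻ : ∀ z → u (ρ z) ∈ neighbours n k (u (ρ (z - 1ℤ)))
  rim⁻ z = subst (u (ρ z) ∈_) (sym (neighbours-u (z - 1ℤ)))
    (here (cong (u ∘ ρ) (sym (i-j+j≡i z 1ℤ))))

  chord⁺ : ∀ z → v (ρ z) ∈ neighbours n k (v (ρ (z + + k)))
  chord⁺ z = subst (v (ρ z) ∈_) (sym (neighbours-v (z + + k)))
    (there (here (cong (v ∘ ρ) (sym (i+j-j≡i z (+ k))))))

  chord⁻ : ∀ z → v (ρ z) ∈ neighbours n k (v (ρ (z - + k)))
  chord⁻ z = subst (v (ρ z) ∈_) (sym (neighbours-v (z - + k)))
    (here (cong (v ∘ ρ) (sym (i-j+j≡i z (+ k)))))

  spoke-u : ∀ i → u i ∈ neighbours n k (v i)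
  spoke-u i = there (there (here refl))

  spoke-v : ∀ i → v i ∈ neighbours n k (u i)
  spoke-v i = there (there (here refl))

  neighbours-sym-ρ : ∀ z {y} →
    (y ∈ neighbours n k (u (ρ z)) → u (ρ z) ∈ neighbours n k y) ×
    (y ∈ neighbours n k (v (ρ z)) → v (ρ z) ∈ neighbours n k y)
  neighbours-sym-ρ z {y} = (λ y∈ → from-u (subst (y ∈_) (neighbours-u z) y∈))
                         , (λ y∈ → from-v (subst (y ∈_) (neighbours-v z) y∈))
    where
    from-u : y ∈ u (ρ (z + 1ℤ)) ∷ u (ρ (z - 1ℤ)) ∷ v (ρ z) ∷ [] → u (ρ z) ∈ neighbours n k y
    from-u (here refl)                 = rim⁺ z
    from-u (there (here refl))         = rim⁻ z
    from-u (there (there (here refl))) = spoke-u (ρ z)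
    from-v : y ∈ v (ρ (z + + k)) ∷ v (ρ (z - + k)) ∷ u (ρ z) ∷ [] → v (ρ z) ∈ neighbours n k y
    from-v (here refl)                 = chord⁺ z
    from-v (there (here refl))         = chord⁻ z
    from-v (there (there (here refl))) = spoke-v (ρ z)

  -- `within` looks for the previous vertex among the neighbours of the last one; symmetry allows
  -- the last step to be analysed from the previous vertex.
  neighbours-sym : ∀ x {y} → y ∈ neighbours n k x → x ∈ neighbours n k y
  neighbours-sym (u i) {y} =
    subst (λ j → y ∈ neighbours n k (u j) → u j ∈ neighbours n k y) (ρ-toℕ i)
      (proj₁ (neighbours-sym-ρ (+ toℕ i)))
  neighbours-sym (v i) {y} =
    subst (λ j → y ∈ neighbours n k (v j) → v j ∈ neighbours n k y) (ρ-toℕ i)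
      (proj₂ (neighbours-sym-ρ (+ toℕ i)))

  module _ (f : ℤ → V n)
           (f⁺ : ∀ z → f z ∈ neighbours n k (f (z + 1ℤ)))
           (f⁻ : ∀ z → f z ∈ neighbours n k (f (z - 1ℤ))) where

    -- Serves the rim and the chord orbits at once: `f` is a line of consecutively adjacent vertices
    -- indexed by ℤ, and `a` is a signed number of steps along it.
    reach-along : ∀ {m x} z a → Reach m x (f z) → Reach (∣ a ∣ ℕ.+ m) x (f (z + a))
    reach-along {m} {x} z (+ zero) r =
      subst (Reach m x ∘ f) (sym (ℤ.+-identityʳ z)) r
    reach-along {m} {x} z (+ suc s) r =
      subst (Reach (suc s ℕ.+ m) x ∘ f) (next z (+ s)) (reach-extend (reach-along z (+ s) r) (f⁺ _))
      where
      next : ∀ z s → z + s + 1ℤ ≡ z + (1ℤ + s)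
      next z s = solve (z ∷ s ∷ [])
    reach-along {m} {x} z -[1+ zero ] r = reach-extend r (f⁻ z)
    reach-along {m} {x} z -[1+ suc s ] r =
      subst (Reach (2 ℕ.+ s ℕ.+ m) x ∘ f) (next z -[1+ s ]) (reach-extend (reach-along z -[1+ s ] r) (f⁻ _))
      where
      next : ∀ z s → z + s - 1ℤ ≡ z + (-1ℤ + s)
      next z s = solve (z ∷ s ∷ [])

  reach-rim : ∀ {m x} z a → Reach m x (u (ρ z)) → Reach (∣ a ∣ ℕ.+ m) x (u (ρ (z + a)))
  reach-rim = reach-along (u ∘ ρ) rim⁺ rim⁻

  reach-chords : ∀ {m x} z b → Reach m x (v (ρ z)) → Reach (∣ b ∣ ℕ.+ m) x (v (ρ (z + b * + k)))
  -- The line is parametrised by the number of chords and starts at `0ℤ`; the outer `subst`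
  -- simplifies the final count `0ℤ + b`.
  reach-chords {m} {x} z b r =
    subst (λ c → Reach (∣ b ∣ ℕ.+ m) x (v (ρ (z + c * + k)))) (ℤ.+-identityˡ b)
      (reach-along (λ c → v (ρ (z + c * + k)))
        (λ c → subst (λ w → v (ρ (z + c * + k)) ∈ neighbours n k (v (ρ w))) (next⁺ z c (+ k)) (chord⁺ (z + c * + k)))
        (λ c → subst (λ w → v (ρ (z + c * + k)) ∈ neighbours n k (v (ρ w))) (next⁻ z c (+ k)) (chord⁻ (z + c * + k)))
        0ℤ b
        (subst (Reach m x ∘ v ∘ ρ) (sym (ℤ.+-identityʳ z)) r))
    where
    next⁺ : ∀ z c k → z + c * k + k ≡ z + (c + 1ℤ) * k
    next⁺ z c k = solve (z ∷ c ∷ k ∷ [])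
    next⁻ : ∀ z c k → z + c * k - k ≡ z + (c - 1ℤ) * k
    next⁻ z c k = solve (z ∷ c ∷ k ∷ [])

  reach-refl : ∀ x → Reach 0 x x
  reach-refl x = reach (==-refl x)

  reach-u-v : ∀ z a b → Reach (∣ b ∣ ℕ.+ suc (∣ a ∣ ℕ.+ 0)) (u (ρ z)) (v (ρ (z + a + b * + k)))
  reach-u-v z a b = reach-chords (z + a) b (reach-extend (reach-rim z a (reach-refl _)) (spoke-u _))

  -- The walk of `reach-u-v` is retraced, chords first and rim last; this bounds the distance in the
  -- reverse order of arguments directly.
  reach-v-u : ∀ z a b → Reach (∣ - a ∣ ℕ.+ suc (∣ - b ∣ ℕ.+ 0)) (v (ρ (z + a + b * + k))) (u (ρ z))
  reach-v-u z a b =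
    subst (Reach (∣ - a ∣ ℕ.+ suc (∣ - b ∣ ℕ.+ 0)) (v (ρ (z + a + b * + k))) ∘ u ∘ ρ) (back z a b (+ k))
      (reach-rim (z + a + b * + k + - b * + k) (- a) (reach-extend (reach-chords (z + a + b * + k) (- b) (reach-refl _)) (spoke-v _)))
    where
    back : ∀ z a b k → z + a + b * k + (- b) * k + - a ≡ z
    back z a b k = solve (z ∷ a ∷ b ∷ k ∷ [])

  dist-u-v : ∀ z a b → dist n k (u (ρ z)) (v (ρ (z + a + b * + k))) ℕ.≤ suc (∣ a ∣ ℕ.+ ∣ b ∣)
  dist-u-v z a b = subst (dist n k (u (ρ z)) (v (ρ (z + a + b * + k))) ℕ.≤_) eq (dist-≤ (reach-u-v z a b))
    where
    open ≡-Reasoning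
    eq : ∣ b ∣ ℕ.+ suc (∣ a ∣ ℕ.+ 0) ≡ suc (∣ a ∣ ℕ.+ ∣ b ∣)
    eq = begin
      ∣ b ∣ ℕ.+ suc (∣ a ∣ ℕ.+ 0) ≡⟨ ℕ.+-suc ∣ b ∣ _ ⟩
      suc (∣ b ∣ ℕ.+ (∣ a ∣ ℕ.+ 0)) ≡⟨ cong (λ c → suc (∣ b ∣ ℕ.+ c)) (ℕ.+-identityʳ _) ⟩
      suc (∣ b ∣ ℕ.+ ∣ a ∣) ≡⟨ cong suc (ℕ.+-comm ∣ b ∣ _) ⟩
      suc (∣ a ∣ ℕ.+ ∣ b ∣) ∎

  dist-v-u : ∀ z a b → dist n k (v (ρ (z + a + b * + k))) (u (ρ z)) ℕ.≤ suc (∣ a ∣ ℕ.+ ∣ b ∣)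
  dist-v-u z a b = subst (dist n k (v (ρ (z + a + b * + k))) (u (ρ z)) ℕ.≤_) eq (dist-≤ (reach-v-u z a b))
    where
    open ≡-Reasoning
    eq : ∣ - a ∣ ℕ.+ suc (∣ - b ∣ ℕ.+ 0) ≡ suc (∣ a ∣ ℕ.+ ∣ b ∣)
    eq = begin
      ∣ - a ∣ ℕ.+ suc (∣ - b ∣ ℕ.+ 0)
        ≡⟨ cong₂ (λ A B → A ℕ.+ suc B) (ℤ.∣-i∣≡∣i∣ a) (trans (ℕ.+-identityʳ _) (ℤ.∣-i∣≡∣i∣ b)) ⟩
      ∣ a ∣ ℕ.+ suc ∣ b ∣ ≡⟨ ℕ.+-suc ∣ a ∣ _ ⟩
      suc (∣ a ∣ ℕ.+ ∣ b ∣) ∎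

-- The vertex list, counting by filters, and the diameter as a maximum.

∈-vertices : ∀ {n} (x : V n) → x ∈ vertices n
∈-vertices (u i) = ∈-++⁺ˡ (∈-map⁺ u (∈-allFin i))
∈-vertices (v i) = ∈-++⁺ʳ (map u (allFin _)) (∈-map⁺ v (∈-allFin i))

vertices-unique : ∀ n → Unique (vertices n)
vertices-unique n = Unique.++⁺ (Unique.map⁺ (λ { refl → refl }) (Unique.allFin⁺ n))
                               (Unique.map⁺ (λ { refl → refl }) (Unique.allFin⁺ n))
                               disjoint
  where
  disjoint : ∀ {x} → x ∈ map u (allFin n) × x ∈ map v (allFin n) → _
  disjoint (x∈u , x∈v) with ∈-map⁻ u x∈u | ∈-map⁻ v x∈v
  ... | _ , _ , refl | _ , _ , ()

length-filter-map : ∀ {A B : Set} {P : B → Set} (P? : Decidable P) (f : A → B) xs →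
                    length (filter P? (map f xs)) ≡ length (filter (P? ∘ f) xs)
length-filter-map P? f []       = refl
length-filter-map P? f (x ∷ xs) with P? (f x)
... | yes _ = cong suc (length-filter-map P? f xs)
... | no  _ = length-filter-map P? f xs

∈⇒≤-max : ∀ {m} ms → m ∈ ms → m ℕ.≤ foldr ℕ._⊔_ 0 ms
∈⇒≤-max (_ ∷ ms) (here refl) = ℕ.m≤m⊔n _ _
∈⇒≤-max (l ∷ ms) (there m∈)  = ℕ.≤-trans (∈⇒≤-max ms m∈) (ℕ.m≤n⊔m l _)

dist≤diam : ∀ n k x y → dist n k x y ℕ.≤ diam n k
dist≤diam n k x y = ∈⇒≤-max _ (∈-concatMap⁺ _ (lose (∈-vertices x) (∈-map⁺ (dist n k x) (∈-vertices y))))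

T-ext : ∀ {a b} → (T a → T b) → (T b → T a) → a ≡ b
T-ext {true}  {true}  f g = refl
T-ext {false} {false} f g = refl
T-ext {true}  {false} f g with () ← f tt
T-ext {false} {true}  f g with () ← g tt

-- Involutive automorphisms preserve distances and balance exchanged pairs.

module Automorphism (n k : ℕ) (σ : V n → V n) (σ-involutive : ∀ x → σ (σ x) ≡ x)
  (σ-neighbours : ∀ x {y} → y ∈ neighbours n k x → σ y ∈ neighbours n k (σ x)) where
  open Walks n k

  reach-σ : ∀ m {x y} → Reach m x y → Reach m (σ x) (σ y)
  reach-σ zero {x} {y} (reach x==y) with refl ← ==⇒≡ x y x==y = reach (==-refl (σ x))
  reach-σ (suc m) {x} {y} r with reach-retract m r
  ... | inj₁ r′            = reach-suc (reach-σ m r′)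
  ... | inj₂ (z , z∈ , r′) = reach-extend (reach-σ m r′) (σ-neighbours y z∈)

  -- Preservation of reachability gives one direction; applied to the images it gives the other, as
  -- `σ` is its own inverse.
  within-σ : ∀ m x y → within n k m (σ x) (σ y) ≡ within n k m x y
  within-σ m x y = T-ext
    (λ t → Reach.holds (subst₂ (Reach m) (σ-involutive x) (σ-involutive y) (reach-σ m (reach t))))
    (λ t → Reach.holds (reach-σ m (reach t)))

  search-σ : ∀ x y s f → search n k (σ x) (σ y) s f ≡ search n k x y s f
  search-σ x y s zero    = refl
  search-σ x y s (suc f) =
    cong₂ (if_then s else_) (within-σ s x y) (search-σ x y (suc s) f)

  dist-σ : ∀ x y → dist n k (σ x) (σ y) ≡ dist n k x y
  dist-σ x y = search-σ x y 0 (2 ℕ.* n)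

  -- Both lists are free of duplicates and contain every vertex, so they agree as bags.
  map-σ-↭ : map σ (vertices n) ↭ vertices n
  map-σ-↭ = ∼bag⇒↭ (unique∧set⇒bag (Unique.map⁺ σ-injective (vertices-unique n)) (vertices-unique n)
    (λ {x} → mk⇔ (λ _ → ∈-vertices x)
      (λ _ → subst (_∈ map σ (vertices n)) (σ-involutive x) (∈-map⁺ σ (∈-vertices (σ x))))))
    where
    σ-injective : ∀ {x y} → σ x ≡ σ y → x ≡ y
    σ-injective {x} {y} eq = trans (sym (σ-involutive x)) (trans (cong σ eq) (σ-involutive y))

  -- Relabelling the vertices by `σ` preserves distances and exchanges `x` with `σ x`, so it carries
  -- one of the two sets onto the other.
  Wsize-σ : ∀ x → Wsize n k x (σ x) ≡ Wsize n k (σ x) x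
  Wsize-σ x = begin
    Wsize n k x (σ x)
      ≡⟨ ↭-length (filter-↭ (closer x (σ x)) map-σ-↭) ⟨
    length (filter (closer x (σ x)) (map σ (vertices n)))
      ≡⟨ length-filter-map (closer x (σ x)) σ (vertices n) ⟩
    length (filter (closer x (σ x) ∘ σ) (vertices n))
      ≡⟨ cong length (filter-≐ (closer x (σ x) ∘ σ) (closer (σ x) x)
           ((λ {w} → subst₂ ℕ._<_ (to-x w) (dist-σ w x))
           , λ {w} → subst₂ ℕ._<_ (sym (to-x w)) (sym (dist-σ w x))) (vertices n)) ⟩
    Wsize n k (σ x) x ∎
    where
    open ≡-Reasoning
    closer : ∀ x y → Decidable (λ w → dist n k w x ℕ.< dist n k w y)
    closer x y w = dist n k w x ℕ.<? dist n k w y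
    to-x : ∀ w → dist n k (σ w) x ≡ dist n k w (σ x)
    to-x w = trans (cong (dist n k (σ w)) (sym (σ-involutive x))) (dist-σ w (σ x))

-- The reflections i ↦ s - i.

module Reflection (N k : ℕ) (k≤n : k ℕ.≤ suc N) (s : ℤ) where
  open import Data.Integer using (_+_; _-_; -_; _*_)
  open Residues N
  open Petersen N k k≤n

  reflect : Fin n → Fin n
  reflect i = ρ (s - + toℕ i)

  reflect-residue : ∀ z → reflect (ρ z) ≡ ρ (s - z)
  reflect-residue z = ρ-cong {s - + toℕ (ρ z)} {s - z} q
      (trans (cong (λ e → s - e) (toℕ-ρ z)) (regroup s z q (+ n)))
    where
    q = z ℤ./ℕ n
    regroup : ∀ s z q n → s - (z - q * n) ≡ s - z + q * n
    regroup s z q n = solve (s ∷ z ∷ q ∷ n ∷ [])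

  σ : V n → V n
  σ (u i) = u (reflect i)
  σ (v i) = v (reflect i)

  reflect-involutive : ∀ i → reflect (reflect i) ≡ i
  reflect-involutive i = begin
    reflect (ρ (s - + toℕ i))   ≡⟨ reflect-residue (s - + toℕ i) ⟩
    ρ (s - (s - + toℕ i))      ≡⟨ cong ρ (cancel s (+ toℕ i)) ⟩
    ρ (+ toℕ i)                ≡⟨ ρ-toℕ i ⟩
    i ∎
    where
    open ≡-Reasoning
    cancel : ∀ s z → s - (s - z) ≡ z
    cancel s z = solve (s ∷ z ∷ [])

  σ-involutive : ∀ x → σ (σ x) ≡ x
  σ-involutive (u i) = cong u (reflect-involutive i)
  σ-involutive (v i) = cong v (reflect-involutive i)

  reflect-+ : ∀ z a → reflect (ρ (z + a)) ≡ ρ (s - z - a)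
  reflect-+ z a = trans (reflect-residue (z + a)) (cong ρ (regroup s z a))
    where
    regroup : ∀ s z a → s - (z + a) ≡ s - z - a
    regroup s z a = solve (s ∷ z ∷ a ∷ [])

  reflect-- : ∀ z a → reflect (ρ (z - a)) ≡ ρ (s - z + a)
  reflect-- z a = trans (reflect-residue (z - a)) (cong ρ (regroup s z a))
    where
    regroup : ∀ s z a → s - (z - a) ≡ s - z + a
    regroup s z a = solve (s ∷ z ∷ a ∷ [])

  -- A reflection reverses orientation: forward and backward neighbours trade places in the list,
  -- and the spoke stays.
  σ-neighbours : ∀ x {y} → y ∈ neighbours n k x → σ y ∈ neighbours n k (σ x)
  σ-neighbours (u i) {y} = subst (λ i → y ∈ neighbours n k (u i) → σ y ∈ neighbours n k (u (reflect i))) (ρ-toℕ i)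
    (λ y∈ → subst (λ j → σ y ∈ neighbours n k (u j)) (sym (reflect-residue z))
      (subst (σ y ∈_) (sym (neighbours-u (s - z))) (go (subst (y ∈_) (neighbours-u z) y∈))))
    where
    z = + toℕ i
    go : y ∈ u (ρ (z + 1ℤ)) ∷ u (ρ (z - 1ℤ)) ∷ v (ρ z) ∷ [] →
         σ y ∈ u (ρ (s - z + 1ℤ)) ∷ u (ρ (s - z - 1ℤ)) ∷ v (ρ (s - z)) ∷ []
    go (here refl)                 = there (here (cong u (reflect-+ z 1ℤ)))
    go (there (here refl))         = here (cong u (reflect-- z 1ℤ))
    go (there (there (here refl))) = there (there (here (cong v (reflect-residue z))))
  σ-neighbours (v i) {y} = subst (λ i → y ∈ neighbours n k (v i) → σ y ∈ neighbours n k (v (reflect i))) (ρ-toℕ i)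
    (λ y∈ → subst (λ j → σ y ∈ neighbours n k (v j)) (sym (reflect-residue z))
      (subst (σ y ∈_) (sym (neighbours-v (s - z))) (go (subst (y ∈_) (neighbours-v z) y∈))))
    where
    z = + toℕ i
    go : y ∈ v (ρ (z + + k)) ∷ v (ρ (z - + k)) ∷ u (ρ z) ∷ [] →
         σ y ∈ v (ρ (s - z + + k)) ∷ v (ρ (s - z - + k)) ∷ u (ρ (s - z)) ∷ []
    go (here refl)                 = there (here (cong v (reflect-+ z (+ k))))
    go (there (here refl))         = here (cong v (reflect-- z (+ k)))
    go (there (there (here refl))) = there (there (here (cong u (reflect-residue z))))

  open Automorphism n k σ σ-involutive σ-neighbours public using (Wsize-σ)

module WsizeSym (N k : ℕ) (k≤n : k ℕ.≤ suc N) where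
  open import Data.Integer using (_+_; _-_; -_; _*_)
  open Residues N

  private
    module R (i j : Fin n) = Reflection N k k≤n (+ toℕ i + + toℕ j)

    swap : ∀ (i j : Fin n) → R.reflect i j i ≡ j
    swap i j = trans (cong ρ (cancel (+ toℕ i) (+ toℕ j))) (ρ-toℕ j)
      where
      cancel : ∀ a b → a + b - a ≡ b
      cancel a b = solve (a ∷ b ∷ [])

  Wsize-u-u : ∀ i j → Wsize n k (u i) (u j) ≡ Wsize n k (u j) (u i)
  Wsize-u-u i j = subst (λ x → Wsize n k (u i) x ≡ Wsize n k x (u i)) (cong u (swap i j))
    (R.Wsize-σ i j (u i))

  Wsize-v-v : ∀ i j → Wsize n k (v i) (v j) ≡ Wsize n k (v j) (v i)
  Wsize-v-v i j = subst (λ x → Wsize n k (v i) x ≡ Wsize n k x (v i)) (cong v (swap i j))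
    (R.Wsize-σ i j (v i))

-- Lower bounds for distances from an outer vertex.

module Cost (N k : ℕ) (k≤n : k ℕ.≤ suc N) (z : ℤ) where
  open import Data.Integer using (_+_; _-_; -_; _*_)
  open Residues N
  open Petersen N k k≤n

  -- c counts the spokes: one for a walk ending at an inner vertex, two for a return to the rim.
  ViaInner : ℕ → ℕ → Fin n → Set
  ViaInner c m i = ∃₂ λ a b → i ≡ ρ (z + a + b * + k) × c ℕ.+ (∣ a ∣ ℕ.+ ∣ b ∣) ℕ.≤ m

  Rim : ℕ → Fin n → Set
  Rim m i = ∃ λ a → i ≡ ρ (z + a) × ∣ a ∣ ℕ.≤ m

  -- A walk is remembered only through the signed totals of its rim steps and chords, whatever their
  -- order. Walks that never leave the rim are kept apart because they pay for no spoke.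
  Cost : ℕ → V n → Set
  Cost m (u i) = ViaInner 2 m i ⊎ Rim m i
  Cost m (v i) = ViaInner 1 m i

  private
    bumpˡ : ∀ c {m} a e b → c ℕ.+ (∣ a ∣ ℕ.+ ∣ b ∣) ℕ.≤ m → ∣ e ∣ ℕ.≤ 1 →
            c ℕ.+ (∣ a + e ∣ ℕ.+ ∣ b ∣) ℕ.≤ suc m
    bumpˡ c {m} a e b le e≤1 = begin
      c ℕ.+ (∣ a + e ∣ ℕ.+ ∣ b ∣)       ≤⟨ ℕ.+-monoʳ-≤ c (ℕ.+-monoˡ-≤ ∣ b ∣ (begin
        ∣ a + e ∣        ≤⟨ ℤ.∣i+j∣≤∣i∣+∣j∣ a e ⟩
        ∣ a ∣ ℕ.+ ∣ e ∣  ≤⟨ ℕ.+-monoʳ-≤ ∣ a ∣ e≤1 ⟩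
        ∣ a ∣ ℕ.+ 1      ≡⟨ ℕ.+-comm ∣ a ∣ 1 ⟩
        suc ∣ a ∣        ∎)) ⟩
      c ℕ.+ suc (∣ a ∣ ℕ.+ ∣ b ∣)       ≡⟨ ℕ.+-suc c _ ⟩
      suc (c ℕ.+ (∣ a ∣ ℕ.+ ∣ b ∣))     ≤⟨ s≤s le ⟩
      suc m                             ∎
      where open ℕ.≤-Reasoning

    swap-+ : ∀ c {m} p q → c ℕ.+ (p ℕ.+ q) ℕ.≤ m → c ℕ.+ (q ℕ.+ p) ℕ.≤ m
    swap-+ c {m} p q = subst (λ s → c ℕ.+ s ℕ.≤ m) (ℕ.+-comm p q)

    bumpʳ : ∀ c {m} a b e → c ℕ.+ (∣ a ∣ ℕ.+ ∣ b ∣) ℕ.≤ m → ∣ e ∣ ℕ.≤ 1 →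
            c ℕ.+ (∣ a ∣ ℕ.+ ∣ b + e ∣) ℕ.≤ suc m
    bumpʳ c {m} a b e le e≤1 = swap-+ c ∣ b + e ∣ ∣ a ∣ (bumpˡ c b e a (swap-+ c ∣ a ∣ ∣ b ∣ le) e≤1)

    shift-a : ∀ z a b k e → z + a + b * k + e ≡ z + (a + e) + b * k
    shift-a z a b k e = solve (z ∷ a ∷ b ∷ k ∷ e ∷ [])

    shift-b⁺ : ∀ z a b k → z + a + b * k + k ≡ z + a + (b + 1ℤ) * k
    shift-b⁺ z a b k = solve (z ∷ a ∷ b ∷ k ∷ [])

    shift-b⁻ : ∀ z a b k → z + a + b * k - k ≡ z + a + (b + -1ℤ) * k
    shift-b⁻ z a b k = solve (z ∷ a ∷ b ∷ k ∷ [])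

    cost-step : ∀ y′ {m y} → Cost m y′ → y ∈ neighbours n k y′ → Cost (suc m) y
    cost-step (u _) {m} {y} (inj₁ (a , b , refl , le)) y∈ =
      via (subst (y ∈_) (neighbours-u w) y∈)
      where
      w = z + a + b * + k
      via : y ∈ u (ρ (w + 1ℤ)) ∷ u (ρ (w - 1ℤ)) ∷ v (ρ w) ∷ [] → Cost (suc m) y
      via (here refl) =
        inj₁ (a + 1ℤ , b , cong ρ (shift-a z a b (+ k) 1ℤ) , bumpˡ 2 a 1ℤ b le (s≤s z≤n))
      via (there (here refl)) =
        inj₁ (a + -1ℤ , b , cong ρ (shift-a z a b (+ k) -1ℤ) , bumpˡ 2 a -1ℤ b le (s≤s z≤n))
      -- A further descent keeps the totals; only one spoke has to be accounted for now, and the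
      -- slack is dropped.
      via (there (there (here refl))) = a , b , refl , ℕ.≤-trans (ℕ.n≤1+n _) (ℕ.m≤n⇒m≤1+n le)
    cost-step (u _) {m} {y} (inj₂ (a , refl , le)) y∈ =
      via (subst (y ∈_) (neighbours-u (z + a)) y∈)
      where
      bump : ∀ e → ∣ e ∣ ℕ.≤ 1 → ∣ a + e ∣ ℕ.≤ suc m
      bump e e≤1 = ℕ.≤-trans (ℤ.∣i+j∣≤∣i∣+∣j∣ a e)
        (ℕ.≤-trans (ℕ.+-mono-≤ le e≤1) (ℕ.≤-reflexive (ℕ.+-comm m 1)))
      via : y ∈ u (ρ (z + a + 1ℤ)) ∷ u (ρ (z + a - 1ℤ)) ∷ v (ρ (z + a)) ∷ [] → Cost (suc m) y
      via (here refl) = inj₂ (a + 1ℤ , cong ρ (ℤ.+-assoc z a 1ℤ) , bump 1ℤ (s≤s z≤n))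
      via (there (here refl)) = inj₂ (a + -1ℤ , cong ρ (ℤ.+-assoc z a -1ℤ) , bump -1ℤ (s≤s z≤n))
      -- The first descent from the rim: no chord so far, and the new step pays for the single
      -- spoke.
      via (there (there (here refl))) =
        a , 0ℤ , cong ρ (sym (ℤ.+-identityʳ (z + a))) ,
        s≤s (subst (ℕ._≤ m) (sym (ℕ.+-identityʳ _)) le)
    cost-step (v _) {m} {y} (a , b , refl , le) y∈ =
      via (subst (y ∈_) (neighbours-v w) y∈)
      where
      w = z + a + b * + k
      via : y ∈ v (ρ (w + + k)) ∷ v (ρ (w - + k)) ∷ u (ρ w) ∷ [] → Cost (suc m) y
      via (here refl) =
        a , b + 1ℤ , cong ρ (shift-b⁺ z a b (+ k)) , bumpʳ 1 a b 1ℤ le (s≤s z≤n)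
      via (there (here refl)) =
        a , b + -1ℤ , cong ρ (shift-b⁻ z a b (+ k)) , bumpʳ 1 a b -1ℤ le (s≤s z≤n)
      via (there (there (here refl))) = inj₁ (a , b , refl , s≤s le)

    cost-suc : ∀ y {m} → Cost m y → Cost (suc m) y
    cost-suc (u _) (inj₁ (a , b , eq , le)) = inj₁ (a , b , eq , ℕ.m≤n⇒m≤1+n le)
    cost-suc (u _) (inj₂ (a , eq , le))     = inj₂ (a , eq , ℕ.m≤n⇒m≤1+n le)
    cost-suc (v _) (a , b , eq , le)        = a , b , eq , ℕ.m≤n⇒m≤1+n le

  -- Induction on the length, splitting off the last edge. With `m` the distance itself, it yields
  -- totals whose cost is at most that distance.
  reach⇒cost : ∀ m y → Reach m (u (ρ z)) y → Cost m y
  reach⇒cost zero y (reach x==y) with refl ← ==⇒≡ (u (ρ z)) y x==y =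
    inj₂ (0ℤ , cong ρ (sym (ℤ.+-identityʳ z)) , z≤n)
  reach⇒cost (suc m) y r with reach-retract m r
  ... | inj₁ r′             = cost-suc y (reach⇒cost m y r′)
  ... | inj₂ (y′ , y′∈ , r′) = cost-step y′ (reach⇒cost m y′ r′) (neighbours-sym y y′∈)

-- Consequences of the lower bound on n.

module NumericHypotheses where
  open import Data.Nat using (_+_; _*_; _≤_; _<_; _%_; _/_; NonZero)

  m*n≤o⇒m≤o/n : ∀ m n o .{{_ : NonZero n}} → m * n ≤ o → m ≤ o / n
  m*n≤o⇒m≤o/n m n o mn≤o = subst (_≤ o / n) (ℕ.m*n/n≡m m n) (ℕ./-monoˡ-≤ n mn≤o)

  -- Take `Q` to be k/2 rounded up; both parity branches of `bound` are then `Q * k` computed as a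
  -- halved product.
  half-bound : ∀ k′ → let k = 5 + k′ in ∃[ Q ] Q + Q ≤ suc k × k ≤ Q + Q × Q * k ≤ bound k
  half-bound k′ = by-parity (k % 2) refl (ℕ.m%n<n k 2)
    where
    k = 5 + k′
    h = k / 2
    -- The last clause of `bound` with its parity test abstracted, so that the known remainder can
    -- be substituted.
    bound-k : Bool → ℕ
    bound-k odd = if odd then (k * (k + 1)) / 2 else (k * k) / 2
    by-parity : ∀ r → k % 2 ≡ r → r < 2 → ∃[ Q ] Q + Q ≤ suc k × k ≤ Q + Q × Q * k ≤ bound k
    by-parity 0 even _ = h , ℕ.m≤n⇒m≤1+n (ℕ.≤-reflexive (sym k≡2h)) , ℕ.≤-reflexive k≡2h ,
      subst (λ r → h * k ≤ bound-k (r ≡ᵇ 1)) (sym even)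
        (m*n≤o⇒m≤o/n (h * k) 2 (k * k) (ℕ.≤-reflexive (trans (regroup h k) (cong (k *_) (sym k≡2h)))))
      where
      regroup : ∀ h k → h * k * 2 ≡ k * (h + h)
      regroup h k = solveℕ (h ∷ k ∷ [])
      double : ∀ h → 0 + h * 2 ≡ h + h
      double h = solveℕ (h ∷ [])
      k≡2h : k ≡ h + h
      k≡2h = trans (ℕ.m≡m%n+[m/n]*n k 2) (trans (cong (_+ h * 2) even) (double h))
    by-parity 1 odd _ = suc h , ℕ.≤-reflexive (sym k+1≡2Q) , ℕ.≤-trans (ℕ.n≤1+n k) (ℕ.≤-reflexive k+1≡2Q) ,
      subst (λ r → suc h * k ≤ bound-k (r ≡ᵇ 1)) (sym odd)
        (m*n≤o⇒m≤o/n (suc h * k) 2 (k * (k + 1)) (ℕ.≤-reflexive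
          (trans (regroup (suc h) k) (cong (k *_) (trans (sym k+1≡2Q) (ℕ.+-comm 1 k))))))
      where
      regroup : ∀ h k → h * k * 2 ≡ k * (h + h)
      regroup h k = solveℕ (h ∷ k ∷ [])
      double : ∀ h → suc (1 + h * 2) ≡ suc h + suc h
      double h = solveℕ (h ∷ [])
      k+1≡2Q : suc k ≡ suc h + suc h
      k+1≡2Q = trans (cong suc (trans (ℕ.m≡m%n+[m/n]*n k 2) (cong (_+ h * 2) odd))) (double h)
    by-parity (suc (suc _)) _ (s≤s (s≤s ()))

  -- The field `remainder` supplies what the choice `c = Q` requires: room for `k + Q + k` below
  -- `n`, and the hypothesis `2Q + 2 ≤ k + q` of `weight-far₂`.
  record Halved (n k : ℕ) .{{_ : NonZero k}} : Set where
    field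
      Q         : ℕ
      2Q≤1+k    : Q + Q ≤ suc k
      k≤2Q      : k ≤ Q + Q
      2≤Q       : 2 ≤ Q
      Q≤n/k     : Q ≤ n / k
      remainder : n % k < Q → 3 ≤ n / k × Q + Q + 2 ≤ k + n / k

  -- A quotient of at most 2 would give `n < Q + 2k`.
  3≤n/k : ∀ n k .{{_ : NonZero k}} {Q} → n % k < Q → Q + 2 * k ≤ n → 3 ≤ n / k
  3≤n/k n k {Q} r<Q h = ℕ.≮⇒≥ λ n/k<3 → ℕ.<-irrefl refl (begin-strict
    n                      ≡⟨ ℕ.m≡m%n+[m/n]*n n k ⟩
    n % k + n / k * k      <⟨ ℕ.+-mono-<-≤ r<Q (ℕ.*-monoˡ-≤ k (ℕ.≤-pred n/k<3)) ⟩
    Q + 2 * k              ≤⟨ h ⟩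
    n                      ∎)
    where open ℕ.≤-Reasoning

  -- For `k` equal to 3 or 4, `Q` is 2 and the bounds 8 and 10 are exactly `Q + 2k`, as `3≤n/k`
  -- requires. From 5 on, the bound yields `Q ≤ n / k`, and `Q ≥ 3` yields the rest.
  halved : ∀ n k .{{_ : NonZero k}} → 3 ≤ k → 2 * k < n → bound k ≤ n → Halved n k
  halved n 1 (s≤s ())
  halved n 2 (s≤s (s≤s ()))
  halved n 3 _ 2k<n 8≤n = record
    { Q = 2 ; 2Q≤1+k = ℕ.≤-refl ; k≤2Q = ℕ.n≤1+n 3 ; 2≤Q = ℕ.≤-refl
    ; Q≤n/k = m*n≤o⇒m≤o/n 2 3 n (ℕ.<⇒≤ 2k<n)
    ; remainder = λ r<2 → 3≤n/k n 3 r<2 8≤n , ℕ.+-monoʳ-≤ 3 (3≤n/k n 3 r<2 8≤n) }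
  halved n 4 _ 2k<n 10≤n = record
    { Q = 2 ; 2Q≤1+k = ℕ.n≤1+n 4 ; k≤2Q = ℕ.≤-refl ; 2≤Q = ℕ.≤-refl
    ; Q≤n/k = m*n≤o⇒m≤o/n 2 4 n (ℕ.<⇒≤ 2k<n)
    ; remainder = λ r<2 → 3≤n/k n 4 r<2 10≤n , ℕ.m≤n⇒m≤1+n (ℕ.+-monoʳ-≤ 3 (3≤n/k n 4 r<2 10≤n)) }
  halved n k@(suc (suc (suc (suc (suc k′))))) _ 2k<n bound≤n
    with Q , 2Q≤1+k , k≤2Q , Qk≤ ← half-bound k′ = record
    { Q = Q ; 2Q≤1+k = 2Q≤1+k ; k≤2Q = k≤2Q ; 2≤Q = ℕ.<⇒≤ 3≤Q
    ; Q≤n/k = Q≤n/k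
    ; remainder = λ _ → ℕ.≤-trans 3≤Q Q≤n/k , (begin
        Q + Q + 2     ≡⟨ regroup Q ⟩
        Q + 2 + Q     ≤⟨ ℕ.+-mono-≤ Q+2≤k Q≤n/k ⟩
        k + n / k     ∎) }
    where
    open ℕ.≤-Reasoning
    3≤Q : 3 ≤ Q
    3≤Q = ℕ.≮⇒≥ λ Q<3 → ℕ.<⇒≱
      (s≤s (ℕ.≤-trans k≤2Q (ℕ.+-mono-≤ (ℕ.≤-pred Q<3) (ℕ.≤-pred Q<3))))
      (ℕ.m≤m+n 5 k′)
    Q≤n/k : Q ≤ n / k
    Q≤n/k = m*n≤o⇒m≤o/n Q k n (ℕ.≤-trans Qk≤ bound≤n)
    Q+2≤k : Q + 2 ≤ k
    Q+2≤k = ℕ.≤-pred (begin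
      suc (Q + 2)  ≡⟨ ℕ.+-suc Q 2 ⟨
      Q + 3        ≤⟨ ℕ.+-monoʳ-≤ Q 3≤Q ⟩
      Q + Q        ≤⟨ 2Q≤1+k ⟩
      suc k        ∎)
    regroup : ∀ Q → Q + Q + 2 ≡ Q + 2 + Q
    regroup Q = solveℕ (Q ∷ [])

-- Distances between outer and inner vertices stay below the diameter.

module Diameter (N k Q c : ℕ) (3≤k : 3 ℕ.≤ k) (2k<n : 2 ℕ.* k ℕ.< suc N)
  (k≤2Q : k ℕ.≤ Q ℕ.+ Q) (k+c+k≤n : k ℕ.+ c ℕ.+ k ℕ.≤ suc N)
  (distant : ∀ a b t → a ℤ.+ b ℤ.* + k ≡ + (k ℕ.+ c) ℤ.+ t ℤ.* + suc N → Q ℕ.≤ ∣ a ∣ ℕ.+ ∣ b ∣)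
  where
  open import Data.Integer using (_+_; _-_; -_; _*_; _≤_)
  open Residues N

  k≤n : k ℕ.≤ n
  k≤n = ℕ.≤-trans (ℕ.m≤m+n k _) (ℕ.<⇒≤ 2k<n)

  open Petersen N k k≤n

  shortcut⁺ : ∀ a → + k ≤ a → 2 ℕ.+ (∣ a - + k ∣ ℕ.+ 1) ℕ.≤ ∣ a ∣
  shortcut⁺ a k≤a = ℤ.drop‿+≤+ (certify (gap (i≤∣i∣ a) ⊕ gap (+≤+ 3≤k))
    (trans (cong (λ w → + ∣ a ∣ - (+ 2 + (w + 1ℤ))) (ℤ.0≤i⇒+∣i∣≡i (gap k≤a)))
           (regroup (+ ∣ a ∣) a (+ k))))
    where
    regroup : ∀ A a k → A - (+ 2 + (a - k + 1ℤ)) ≡ A - a + (k - + 3)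
    regroup A a k = solve (A ∷ a ∷ k ∷ [])

  -- Since k ≥ 3, one chord replaces k rim edges profitably even after paying for two spokes.
  shortcut : ∀ a → + k ≤ a ⊎ + k ≤ - a →
             ∃₂ λ a′ b → a ≡ a′ + b * + k × 2 ℕ.+ (∣ a′ ∣ ℕ.+ ∣ b ∣) ℕ.≤ ∣ a ∣
  shortcut a (inj₁ k≤a) = a - + k , 1ℤ , regroup a (+ k) , shortcut⁺ a k≤a
    where
    regroup : ∀ a k → a ≡ a - k + 1ℤ * k
    regroup a k = solve (a ∷ k ∷ [])
  shortcut a (inj₂ k≤-a) = - (- a - + k) , -1ℤ , regroup a (+ k) ,
    subst₂ (λ p q → 2 ℕ.+ (p ℕ.+ 1) ℕ.≤ q) (sym (ℤ.∣-i∣≡∣i∣ (- a - + k))) (ℤ.∣-i∣≡∣i∣ a)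
      (shortcut⁺ (- a) k≤-a)
    where
    regroup : ∀ a k → a ≡ - (- a - k) + -1ℤ * k
    regroup a k = solve (a ∷ k ∷ [])

  -- For `t ≤ 0`, `a = j - tn` is at least `j ≥ k`; for `t ≥ 1` it is at most `j - n ≤ -k`.
  outside : ∀ {j} a t → k ℕ.≤ j → j ℕ.+ k ℕ.≤ n → + j ≡ a + t * + n → + k ≤ a ⊎ + k ≤ - a
  outside {j} a t k≤j j+k≤n eq with split t 0ℤ
  ... | inj₁ t≤0 = inj₁ (certify (gap (+≤+ k≤j) ⊕ gap t≤0 ⊗ (+≤+ {n = n} z≤n) ⊕ gap (ℤ.≤-reflexive eq))
                     (regroup (+ k) (+ j) a t (+ n)))
    where
    regroup : ∀ k j a t n → a - k ≡ j - k + (0ℤ - t) * n + (a + t * n - j)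
    regroup k j a t n = solve (k ∷ j ∷ a ∷ t ∷ n ∷ [])
  ... | inj₂ 1≤t = inj₂ (certify (gap (+≤+ j+k≤n) ⊕ gap 1≤t ⊗ (+≤+ {n = n} z≤n) ⊕ gap (ℤ.≤-reflexive (sym eq)))
                     (regroup (+ k) (+ j) a t (+ n)))
    where
    regroup : ∀ k j a t n → - a - k ≡ n - (j + k) + (t - (0ℤ + 1ℤ)) * n + (j - (a + t * n))
    regroup k j a t n = solve (k ∷ j ∷ a ∷ t ∷ n ∷ [])

  cancel-base : ∀ z i j t → z + i ≡ z + j + t → i ≡ j + t
  cancel-base z i j t eq = ∙-cancelˡ z i (j + t) (trans eq (ℤ.+-assoc z j t))

  -- A shortest walk has one of the two forms in `Cost`. On this range of `j` a pure rim walk makes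
  -- at least `k` net steps in one direction, so `shortcut` converts it into a walk through inner
  -- vertices at no extra cost.
  rim-distance : ∀ z j → k ℕ.≤ j → j ℕ.+ k ℕ.≤ n → ∃₂ λ a b → ρ (z + + j) ≡ ρ (z + a + b * + k) ×
                 2 ℕ.+ (∣ a ∣ ℕ.+ ∣ b ∣) ℕ.≤ dist n k (u (ρ z)) (u (ρ (z + + j)))
  rim-distance z j k≤j j+k≤n = improve (Cost.reach⇒cost N k k≤n z D target (dist-reach reached j<2n))
    where
    target : V n
    target = u (ρ (z + + j))
    D = dist n k (u (ρ z)) target
    reached : Reach (j ℕ.+ 0) (u (ρ z)) target
    reached = reach-rim z (+ j) (reach-refl (u (ρ z)))
    -- The search has fuel `2 * n`; a walk shorter than that guarantees that the distance found is
    -- attained.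
    j<2n : j ℕ.+ 0 ℕ.< 2 ℕ.* n
    j<2n = begin-strict
      j ℕ.+ 0     ≡⟨ ℕ.+-identityʳ j ⟩
      j           ≤⟨ ℕ.m≤m+n j k ⟩
      j ℕ.+ k     ≤⟨ j+k≤n ⟩
      n           <⟨ ℕ.m<m+n n (s≤s z≤n) ⟩
      2 ℕ.* n     ∎
      where open ℕ.≤-Reasoning
    improve : Cost.Cost N k k≤n z D target →
              ∃₂ λ a b → ρ (z + + j) ≡ ρ (z + a + b * + k) × 2 ℕ.+ (∣ a ∣ ℕ.+ ∣ b ∣) ℕ.≤ D
    improve (inj₁ through) = through
    improve (inj₂ (a , eq , le)) =
      let t , eq′ = ρ-injective {z + + j} {z + a} eq
          a′ , b , a≡ , le′ = shortcut a (outside a t k≤j j+k≤n (cancel-base z (+ j) a (t * + n) eq′))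
      in a′ , b , trans eq (cong ρ (trans (cong (λ e → z + e) a≡) (sym (ℤ.+-assoc z a′ (b * + k))))) ,
         ℕ.≤-trans le′ le

  distant-pair : ∀ z → 2 ℕ.+ Q ℕ.≤ dist n k (u (ρ z)) (u (ρ (z + + (k ℕ.+ c))))
  distant-pair z =
    let a , b , eq , le = rim-distance z (k ℕ.+ c) (ℕ.m≤m+n k c) k+c+k≤n
        t , eq′ = ρ-injective {z + a + b * + k} {z + + (k ℕ.+ c)} (sym eq)
    in ℕ.≤-trans (s≤s (s≤s (distant a b t (cancel-base z (a + b * + k) (+ (k ℕ.+ c)) (t * + n)
         (trans (sym (ℤ.+-assoc z a (b * + k))) eq′))))) le

  -- Up to `Q`, walk along the rim. Beyond `Q`, take one chord and walk back `k - e` steps: the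
  -- weight `k - e + 1` is at most `k - Q`, hence at most `Q`.
  light : ∀ e → e ℕ.≤ k → ∃₂ λ a b → + e ≡ a + b * + k × ∣ a ∣ ℕ.+ ∣ b ∣ ℕ.≤ Q
  light e e≤k with e ℕ.≤? Q
  ... | yes e≤Q = + e , 0ℤ , sym (ℤ.+-identityʳ (+ e)) , subst (ℕ._≤ Q) (sym (ℕ.+-identityʳ e)) e≤Q
  ... | no  e≰Q = - (+ k - + e) , 1ℤ , regroup (+ k) (+ e) , ℤ.drop‿+≤+ (certify
      (gap (+≤+ k≤2Q) ⊕ gap (+≤+ (ℕ.≰⇒> e≰Q)))
      (trans (cong (λ w → + Q - (w + 1ℤ)) (trans (cong +_ (ℤ.∣-i∣≡∣i∣ (+ k - + e))) (ℤ.0≤i⇒+∣i∣≡i (gap (+≤+ e≤k)))))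
             (balance (+ Q) (+ k) (+ e))))
    where
    regroup : ∀ k e → e ≡ - (k - e) + 1ℤ * k
    regroup k e = solve (k ∷ e ∷ [])
    balance : ∀ Q k e → Q - (k - e + 1ℤ) ≡ Q + Q - k + (e - (1ℤ + Q))
    balance Q k e = solve (Q ∷ k ∷ e ∷ [])

  -- The totals `a`, `b` bound the distance between an outer and an inner vertex by
  -- `suc (∣ a ∣ + ∣ b ∣)`, and some pair is farther apart: in the middle range the outer pair with
  -- the same offset `δ`, which pays one more spoke; otherwise the pair of `distant-pair`.
  mixed-gap : ∀ z δ → δ ℕ.< n → ∃₂ λ a b → ∃₂ λ x y →
              ρ (z + + δ) ≡ ρ (z + a + b * + k) × suc (∣ a ∣ ℕ.+ ∣ b ∣) ℕ.< dist n k x y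
  mixed-gap z δ δ<n = by-position (k ℕ.≤? δ) (δ ℕ.+ k ℕ.≤? n)
    where
    Gap = ∃₂ λ a b → ∃₂ λ x y →
          ρ (z + + δ) ≡ ρ (z + a + b * + k) × suc (∣ a ∣ ℕ.+ ∣ b ∣) ℕ.< dist n k x y

    light-gap : ∀ a b → ρ (z + + δ) ≡ ρ (z + a + b * + k) → ∣ a ∣ ℕ.+ ∣ b ∣ ℕ.≤ Q → Gap
    light-gap a b eq le =
      a , b , u (ρ z) , u (ρ (z + + (k ℕ.+ c))) , eq , ℕ.≤-trans (s≤s (s≤s le)) (distant-pair z)

    turn : ∀ z δ n → z + δ ≡ z - (n - δ) + 1ℤ * n
    turn z δ n = solve (z ∷ δ ∷ n ∷ [])
    regroup : ∀ z a b k n → z - (a + b * k) + n ≡ z + - a + - b * k + n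
    regroup z a b k n = solve (z ∷ a ∷ b ∷ k ∷ n ∷ [])
    wrap : ∀ a b → + (n ℕ.∸ δ) ≡ a + b * + k → z + + δ ≡ z + - a + - b * + k + 1ℤ * + n
    wrap a b eq = trans (turn z (+ δ) (+ n))
      (trans (cong (λ e → z - e + 1ℤ * + n) (trans (ℤ.m-n≡m⊖n n δ) (trans (ℤ.⊖-≥ (ℕ.<⇒≤ δ<n)) eq)))
             (regroup z a b (+ k) (1ℤ * + n)))

    by-position : Dec (k ℕ.≤ δ) → Dec (δ ℕ.+ k ℕ.≤ n) → Gap
    by-position (yes k≤δ) (yes δ+k≤n) =
      let a , b , eq , le = rim-distance z δ k≤δ δ+k≤n
      in a , b , u (ρ z) , u (ρ (z + + δ)) , eq , le
    by-position (no k≰δ) _ =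
      let a , b , eq , le = light δ (ℕ.<⇒≤ (ℕ.≰⇒> k≰δ))
      in light-gap a b (cong ρ (trans (cong (λ e → z + e) eq) (sym (ℤ.+-assoc z a (b * + k))))) le
    -- Here `n ∸ δ` is at most `k`: its totals are negated, and the result is one turn away from
    -- `δ`.
    by-position (yes _) (no δ+k≰n) =
      let a , b , eq , le = light (n ℕ.∸ δ) (ℕ.m≤n+o⇒m∸n≤o n δ (ℕ.<⇒≤ (ℕ.≰⇒> δ+k≰n)))
      in light-gap (- a) (- b) (ρ-cong {z + + δ} {z + - a + - b * + k} 1ℤ (wrap a b eq))
           (subst₂ (λ p q → p ℕ.+ q ℕ.≤ Q) (sym (ℤ.∣-i∣≡∣i∣ a)) (sym (ℤ.∣-i∣≡∣i∣ b)) le)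

  difference : ∀ (i j : Fin n) → ρ (+ toℕ i + + toℕ (ρ (+ toℕ j - + toℕ i))) ≡ j
  difference i j = trans (ρ-cong {z′ = + toℕ j} (- q) (begin
    z + + toℕ (ρ (w - z))    ≡⟨ cong (λ e → z + e) (toℕ-ρ (w - z)) ⟩
    z + (w - z - q * + n)    ≡⟨ cancel z w q (+ n) ⟩
    w + - q * + n            ∎)) (ρ-toℕ j)
    where
    open ≡-Reasoning
    z = + toℕ i
    w = + toℕ j
    q = (w - z) ℤ./ℕ n
    cancel : ∀ z w q n → z + (w - z - q * n) ≡ w + - q * n
    cancel z w q n = solve (z ∷ w ∷ q ∷ n ∷ [])

  mixed<diam : ∀ i j → dist n k (u i) (v j) ℕ.< diam n k × dist n k (v j) (u i) ℕ.< diam n k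
  mixed<diam i j =
    let a , b , x , y , eq , lt = mixed-gap z δ (Fin.toℕ<n (ρ (+ toℕ j - z)))
        j≡ = trans (sym eq) (difference i j)
        lt′ = ℕ.<-≤-trans lt (dist≤diam n k x y)
    in ℕ.≤-<-trans (subst₂ (λ i j → dist n k (u i) (v j) ℕ.≤ suc (∣ a ∣ ℕ.+ ∣ b ∣)) (ρ-toℕ i) j≡ (dist-u-v z a b)) lt′
     , ℕ.≤-<-trans (subst₂ (λ i j → dist n k (v j) (u i) ℕ.≤ suc (∣ a ∣ ℕ.+ ∣ b ∣)) (ρ-toℕ i) j≡ (dist-v-u z a b)) lt′
    where
    z = + toℕ i
    δ = toℕ (ρ (+ toℕ j - z))

  diam-balanced : DistanceBalanced n k (diam n k)
  diam-balanced (u i) (u j) _  = WsizeSym.Wsize-u-u N k k≤n i j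
  diam-balanced (v i) (v j) _  = WsizeSym.Wsize-v-v N k k≤n i j
  diam-balanced (u i) (v j) eq = contradiction eq (ℕ.<⇒≢ (proj₁ (mixed<diam i j)))
  diam-balanced (v i) (u j) eq = contradiction eq (ℕ.<⇒≢ (proj₂ (mixed<diam j i)))

-- Choice of the distant residue and conclusion.

open import Data.Nat using (_≤_; _<_; _*_)

theorem1p3 : ∀ (n k : ℕ) → 3 ≤ k → 2 * k < n → bound k ≤ n →
    DistanceBalanced n k (diam n k)
theorem1p3 n@(suc N) k@(suc _) 3≤k 2k<n bound≤n = by-remainder (Q ℕ.≤? r)
  where
  open NumericHypotheses
  open Halved (halved n k 3≤k 2k<n bound≤n)
  open import Data.Nat using (_+_)
  open ℕ.≤-Reasoning
  q = n ℕ./ k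
  r = n ℕ.% k

  n≡r+qk : n ≡ r + q * k
  n≡r+qk = ℕ.m≡m%n+[m/n]*n n k

  balanced : ∀ c → Q ≤ suc c → c ≤ Q → c < r ⊎ r < c × Q + Q + 2 ≤ k + q → c + 2 * k ≤ n →
             DistanceBalanced n k (diam n k)
  balanced c Q≤1+c c≤Q c-r c+2k≤n = Diameter.diam-balanced N k Q c 3≤k 2k<n k≤2Q k+c+k≤n
    (Distant.weight-distant (s≤s z≤n) Q≤1+c c≤Q 2Q≤1+k Q≤n/k c-r
      (trans n≡r+qk (ℕ.+-comm r (q * k))) (ℕ.m+n≤o⇒m≤o (k + c) k+c+k≤n))
    where
    regroup : ∀ k c → k + c + k ≡ c + 2 * k
    regroup k c = solveℕ (k ∷ c ∷ [])
    k+c+k≤n : k + c + k ≤ n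
    k+c+k≤n = subst (_≤ n) (sym (regroup k c)) c+2k≤n

  by-remainder : Dec (Q ≤ r) → DistanceBalanced n k (diam n k)
  -- With `c = Q - 1 < r` the case `weight-far₁` applies, and `c + 2k ≤ r + qk` since `q ≥ Q ≥ 2`.
  by-remainder (yes Q≤r) = balanced c (ℕ.≤-reflexive (sym 1+c≡Q)) ℕ.pred[n]≤n (inj₁ c<r) (begin
    c + 2 * k   ≤⟨ ℕ.+-mono-≤ (ℕ.<⇒≤ c<r) (ℕ.*-monoˡ-≤ k (ℕ.≤-trans 2≤Q Q≤n/k)) ⟩
    r + q * k   ≡⟨ n≡r+qk ⟨
    n           ∎)
    where
    c = ℕ.pred Q
    1+c≡Q : suc c ≡ Q
    1+c≡Q = ℕ.suc-pred Q {{ℕ.>-nonZero (ℕ.<⇒≤ 2≤Q)}}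
    c<r : c < r
    c<r = subst (_≤ r) (sym 1+c≡Q) Q≤r
  -- With `c = Q > r` the case `weight-far₂` applies; the room below `n` comes from `Q ≤ k` and
  -- `3 ≤ q`.
  by-remainder (no Q≰r) with 3≤q , 2Q+2≤k+q ← remainder (ℕ.≰⇒> Q≰r) =
    balanced Q (ℕ.n≤1+n Q) ℕ.≤-refl (inj₂ (ℕ.≰⇒> Q≰r , 2Q+2≤k+q)) (begin
      Q + 2 * k   ≤⟨ ℕ.+-monoˡ-≤ (2 * k) Q≤k ⟩
      3 * k       ≤⟨ ℕ.*-monoˡ-≤ k 3≤q ⟩
      q * k       ≤⟨ ℕ.m≤n+m (q * k) r ⟩
      r + q * k   ≡⟨ n≡r+qk ⟨
      n           ∎)
    where
    Q≤k : Q ≤ k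
    Q≤k = ℕ.≤-pred (ℕ.≤-trans (ℕ.+-monoˡ-≤ Q (ℕ.<⇒≤ 2≤Q)) 2Q≤1+k)
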